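{- Let $\mathcal R$ be a left-linear TRS which is terminating modulo $\mathcal B$. Then $\mathcal R$ is Church–Rosser modulo $\mathcal B$ if and only if $\mathrm{PCP}(\mathcal R)\cup\mathrm{PCP}^\pm(\mathcal R,\mathcal B^\pm)\subseteq\ \downarrow^\sim_{\mathcal R}$.
   Context: Terms are built from a signature $\mathcal F$ and variables $\mathcal V$. A rule $\ell\to r$ is a pair of terms with $\ell\notin\mathcal V$ and $\mathrm{Var}(r)\subseteq\mathrm{Var}(\ell)$; a TRS is a set of rules, an ES a set of equations; a TRS is left-linear if no left-hand side contains a variable twice. For a set $\mathcal E$ of pairs of terms, $s\to_{\mathcal E}t$ iff $s|_p=\ell\sigma$ and $t=s[r\sigma]_p$ for some $(\ell,r)\in\mathcal E$, position $p$ and substitution $\sigma$; $\leftarrow_{\mathcal E}$ is its inverse. $\mathcal B$ is a fixed ES with $\mathrm{Var}(\ell)=\mathrm{Var}(r)$ for all $\ell\approx r\in\mathcal B$; $\sim_{\mathcal B}=\leftrightarrow^*_{\mathcal B}$ and $\mathcal B^\pm=\mathcal B\cup\{t\approx s\mid s\approx t\in\mathcal B\}$. For a TRS $\mathcal R$: $\to_{\mathcal R/\mathcal B}=\sim_{\mathcal B}\cdot\to_{\mathcal R}\cdot\sim_{\mathcal B}$; $s\downarrow^\sim_{\mathcal R}t$ iff $s\to^*_{\mathcal R}\cdot\sim_{\mathcal B}\cdot\leftarrow^*_{\mathcal R}t$. $\mathcal R$ is terminating modulo $\mathcal B$ if there is no infinite $\to_{\mathcal R/\mathcal B}$-sequence,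 and Church–Rosser modulo $\mathcal B$ if $\leftrightarrow^*_{\mathcal R\cup\mathcal B}\subseteq\ \downarrow^\sim_{\mathcal R}$. Critical pairs: for sets of oriented pairs $\mathcal R_1,\mathcal R_2$ (equations of $\mathcal B^\pm$ read as oriented pairs), an overlap is $\langle\ell_1\to r_1,p,\ell_2\to r_2\rangle$ with $\ell_i\to r_i$ variants of elements of $\mathcal R_i$ without common variables, $p$ a non-variable position of $\ell_2$, $\ell_1$ and $\ell_2|_p$ unifiable, and the two rules not variants of each other if $p=\epsilon$. With an mgu $\sigma$ this yields the critical peak $\ell_2\sigma[r_1\sigma]_p\leftarrow^p\ell_2\sigma\to^\epsilon r_2\sigma$ and critical pair $\ell_2\sigma[r_1\sigma]_p\approx r_2\sigma$. A critical peak $t\leftarrow^p s\to^\epsilon u$ is prime if all proper subterms of $s|_p$ are normal forms of $\to_{\mathcal R}$ (irreducibility is always checked w.r.t. $\mathcal R$, also for overlaps involving $\mathcal B^\pm$). $\mathrm{PCP}(\mathcal R)$ is the set of prime critical pairs from overlaps of $\mathcal R$ with itself; $\mathrm{PCP}^\pm(\mathcal R,\mathcal B^\pm)$ is the set of prime critical pairs from overlaps $\langle\rho_1,p,\rho_2\rangle$ with $\rho_1\in\mathcal R,\rho_2\in\mathcal B^\pm$ or $\rho_1\in\mathcal B^\pm,\rho_2\in\mathcal R$. The inclusion of a set of equations in a relation means each $s\approx t$ in the set satisfies $s\downarrow^\sim_{\mathcal R}t$. -}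

module Defs where

open import Data.List.Base using (List; []; _∷_; _++_)
open import Data.List.Relation.Binary.Disjoint.Propositional using (Disjoint)
open import Data.List.Relation.Binary.Subset.Propositional using (_⊆_)
open import Data.List.Relation.Unary.Unique.Propositional using (Unique)
open import Data.Maybe.Base as Maybe using (Maybe; just; nothing)
open import Data.Nat.Base using (ℕ; zero; suc)
open import Data.Product.Base using (_×_; _,_; ∃-syntax; ∃₂; Σ-syntax; proj₁)
open import Data.Vec.Base using (Vec; []; _∷_)
open import Function.Base using (flip; _∘_)
open import Function.Bundles using (_↔_; Inverse)
open import Level using (0ℓ)
open import Relation.Binary.Core using (Rel; _⇒_)
open import Relation.Binary.Construct.Closure.Equivalence using (EqClosure)
open import Relation.Binary.Construct.Closure.ReflexiveTransitive using (Star)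
open import Relation.Binary.Construct.Closure.Symmetric using (SymClosure)
open import Relation.Binary.Construct.Composition using (_;_)
open import Relation.Binary.Construct.Union using (_∪_)
open import Relation.Binary.PropositionalEquality.Core using (_≡_; _≢_)
open import Relation.Binary.Rewriting using (IsNormalForm)
open import Relation.Nullary.Negation.Core using (¬_)

record Signature : Set₁ where
  field
    Symbol : Set
    arity  : Symbol → ℕ

open Signature public

data Term (F : Signature) (V : Set) : Set where
  var : V → Term F V
  fun : (f : Symbol F) → Vec (Term F V) (arity F f) → Term F V

-- Positions are sequences of argument indices, counted from 0; [] is the
-- root position ε.  A sequence need not be a position of a given term, which
-- is why subterm and replacement below are partial.
Position : Set
Position = List ℕ

module _ {F : Signature} {V : Set} where

  private
    T : Set
    T = Term F V

  IsVar : T → Set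
  IsVar t = ∃[ x ] t ≡ var x

  -- The variable occurrences of a term from left to right, so that Var(t) is
  -- the set of elements of vars t, and t is linear iff vars t has no
  -- repetitions.
  vars  : T → List V
  varsᵛ : ∀ {n} → Vec T n → List V

  vars (var x)    = x ∷ []
  vars (fun f ts) = varsᵛ ts

  varsᵛ []       = []
  varsᵛ (t ∷ ts) = vars t ++ varsᵛ ts

  infix 8 _∣_ _[_]at_

  _∣_   : T → Position → Maybe T
  argAt : ∀ {n} → Vec T n → ℕ → Position → Maybe T

  t        ∣ []      = just t
  var x    ∣ (i ∷ p) = nothing
  fun f ts ∣ (i ∷ p) = argAt ts i p

  argAt []       i       p = nothing
  argAt (t ∷ ts) zero    p = t ∣ p
  argAt (t ∷ ts) (suc i) p = argAt ts i p

  -- s [ u ]at p is s[u]ₚ.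
  _[_]at_      : T → T → Position → Maybe T
  replaceArg : ∀ {n} → Vec T n → T → ℕ → Position → Maybe (Vec T n)

  t        [ u ]at []      = just u
  var x    [ u ]at (i ∷ p) = nothing
  fun f ts [ u ]at (i ∷ p) = Maybe.map (fun f) (replaceArg ts u i p)

  replaceArg []       u i       p = nothing
  replaceArg (t ∷ ts) u zero    p = Maybe.map (_∷ ts) (t [ u ]at p)
  replaceArg (t ∷ ts) u (suc i) p = Maybe.map (t ∷_) (replaceArg ts u i p)

Substitution : Signature → Set → Set
Substitution F V = V → Term F V

-- Both rules and equations; a set of them is a binary relation on terms.
Pair : Signature → Set → Set
Pair F V = Term F V × Term F V

module _ {F : Signature} {V : Set} where

  private
    T : Set
    T = Term F V

  infixl 9 _·_ _·ᵛ_

  _·_  : T → Substitution F V → T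
  _·ᵛ_ : ∀ {n} → Vec T n → Substitution F V → Vec T n

  var x    · σ = σ x
  fun f ts · σ = fun f (ts ·ᵛ σ)

  []       ·ᵛ σ = []
  (t ∷ ts) ·ᵛ σ = (t · σ) ∷ (ts ·ᵛ σ)

  record IsTRS (R : Rel T 0ℓ) : Set where
    field
      lhs-nonvar : ∀ {ℓ r} → R ℓ r → ¬ IsVar ℓ
      rhs-vars   : ∀ {ℓ r} → R ℓ r → vars r ⊆ vars ℓ

  LeftLinear : Rel T 0ℓ → Set
  LeftLinear R = ∀ {ℓ r} → R ℓ r → Unique (vars ℓ)

  VariablePreserving : Rel T 0ℓ → Set
  VariablePreserving B = ∀ {ℓ r} → B ℓ r → vars ℓ ⊆ vars r × vars r ⊆ vars ℓ

  record Step (E : Rel T 0ℓ) (s t : T) : Set where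
    field
      {ℓ r}  : T
      p      : Position
      σ      : Substitution F V
      rule   : E ℓ r
      redex  : s ∣ p ≡ just (ℓ · σ)
      result : s [ r · σ ]at p ≡ just t

  _^± : Rel T 0ℓ → Rel T 0ℓ
  B ^± = SymClosure B

  Equiv : Rel T 0ℓ → Rel T 0ℓ
  Equiv B = EqClosure (Step B)

  StepModulo : (R B : Rel T 0ℓ) → Rel T 0ℓ
  StepModulo R B = Equiv B ; Step R ; Equiv B

  JoinableModulo : (R B : Rel T 0ℓ) → Rel T 0ℓ
  JoinableModulo R B = Star (Step R) ; Equiv B ; flip (Star (Step R))

  TerminatingModulo : (R B : Rel T 0ℓ) → Set
  TerminatingModulo R B =
    ¬ (Σ[ f ∈ (ℕ → T) ] ((n : ℕ) → StepModulo R B (f n) (f (suc n))))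

  ChurchRosserModulo : (R B : Rel T 0ℓ) → Set
  ChurchRosserModulo R B = EqClosure (Step (R ∪ B)) ⇒ JoinableModulo R B

  IsUnifier : Substitution F V → T → T → Set
  IsUnifier σ s t = s · σ ≡ t · σ

  Unifiable : T → T → Set
  Unifiable s t = ∃[ σ ] IsUnifier σ s t

  IsMGU : Substitution F V → T → T → Set
  IsMGU σ s t = IsUnifier σ s t ×
    (∀ τ → IsUnifier τ s t → ∃[ δ ] (∀ x → τ x ≡ σ x · δ))

  pairVars : Pair F V → List V
  pairVars (ℓ , r) = vars ℓ ++ vars r

  -- Variants differ by a renaming, i.e. a bijection on the variables.
  Variant : Rel (Pair F V) 0ℓ
  Variant (ℓ , r) (ℓ′ , r′) =
    ∃[ π ] (ℓ ≡ ℓ′ · rename π × r ≡ r′ · rename π)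
    where
    rename : V ↔ V → Substitution F V
    rename π = var ∘ Inverse.to π

  VariantOfElement : Rel T 0ℓ → Pair F V → Set
  VariantOfElement E ρ = ∃₂ λ ℓ r → E ℓ r × Variant ρ (ℓ , r)

  -- ⟨ρ₁, p, ρ₂⟩ is an overlap of R₁ and R₂; ρ₂ is the rule applied at the root.
  record IsOverlap (R₁ R₂ : Rel T 0ℓ)
                   (ρ₁ : Pair F V) (p : Position) (ρ₂ : Pair F V) : Set where
    field
      variant₁  : VariantOfElement R₁ ρ₁
      variant₂  : VariantOfElement R₂ ρ₂
      apart     : Disjoint (pairVars ρ₁) (pairVars ρ₂)
      {ℓ₂∣p}    : T
      position  : proj₁ ρ₂ ∣ p ≡ just ℓ₂∣p
      nonvar    : ¬ IsVar ℓ₂∣p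
      unifiable : Unifiable (proj₁ ρ₁) ℓ₂∣p
      nontriv   : p ≡ [] → ¬ Variant ρ₁ ρ₂

  -- The critical peak t ←ᵖ s →ᵋ u; every choice of variants and of the mgu
  -- is admitted.
  record CriticalPeak (R₁ R₂ : Rel T 0ℓ)
                      (t : T) (p : Position) (s u : T) : Set where
    field
      {ℓ₁ r₁ ℓ₂ r₂} : T
      isOverlap : IsOverlap R₁ R₂ (ℓ₁ , r₁) p (ℓ₂ , r₂)
      σ         : Substitution F V
      mgu       : IsMGU σ ℓ₁ (IsOverlap.ℓ₂∣p isOverlap)
      source    : s ≡ ℓ₂ · σ
      left      : (ℓ₂ · σ) [ r₁ · σ ]at p ≡ just t
      right     : u ≡ r₂ · σ

  ProperSubtermsNormal : Rel T 0ℓ → T → Set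
  ProperSubtermsNormal R t =
    ∀ {q v} → q ≢ [] → t ∣ q ≡ just v → IsNormalForm (Step R) v

  -- Primality depends only on the source s and the position p of the peak,
  -- and always refers to R, whatever systems the overlap comes from.
  Prime : Rel T 0ℓ → T → Position → Set
  Prime R s p = ∀ {s∣p} → s ∣ p ≡ just s∣p → ProperSubtermsNormal R s∣p

  PrimeCriticalPair : (R R₁ R₂ : Rel T 0ℓ) → Rel T 0ℓ
  PrimeCriticalPair R R₁ R₂ t u =
    ∃₂ λ s p → CriticalPeak R₁ R₂ t p s u × Prime R s p

  PCP : Rel T 0ℓ → Rel T 0ℓ
  PCP R = PrimeCriticalPair R R R

  PCP± : (R B± : Rel T 0ℓ) → Rel T 0ℓ
  PCP± R B± = PrimeCriticalPair R R B± ∪ PrimeCriticalPair R B± R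

{-# OPTIONS --safe #-}

-- Prime critical pairs suffice because a peak or cliff t ← s → u that is not
-- prime can be routed through an innermost redex: contracting it gives s → v
-- with both t, v and v, u arising from prime critical pairs or variable
-- overlaps, so that t ↓ v ↓ u.  By well-founded induction on →_{R/B} the term
-- v is confluent modulo B, hence t ↓ u, and local joinability of peaks and
-- cliffs yields the Church–Rosser property as in Newman's lemma.
-- Left-linearity is used for B-steps inside the substitution part of an
-- R-redex: they must leave an instance of the left-hand side.
module Submission where

-- Joinability modulo `B` composes only through a middle term already known to be confluent, so
-- during the induction the middle terms must lie strictly below the current one with respect to
-- `_⇝_`. Since `_⇝_` absorbs equivalence steps, the induction treats a whole `_~_`-class at once.
-- The delicate case is a chain of equivalence steps next to a rewrite step: a join might use no
-- rewrite step on the equational side, leaving nothing smaller to continue from. Acyclicity of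
-- `_⇝_` rules this out. On the term level the rerouting is not circular, because `Joins` asks for
-- primality of the inner step only. The step at an innermost redex is prime itself, so against any
-- root step it is settled directly by critical pairs and variable overlaps.

open import Axiom.ExcludedMiddle using (ExcludedMiddle)
open import Data.Empty using (⊥-elim)
open import Data.Fin.Base using (Fin; zero; suc; toℕ)
open import Data.Fin.Properties using (_≟_)
open import Data.List.Base as List using (List; []; _∷_; _++_)
open import Data.List.Membership.Propositional using (_∈_; _∉_)
open import Data.List.Membership.Propositional.Properties using (∈-++⁺ˡ; ∈-++⁺ʳ; ∈-++⁻; ∈-map⁺)
open import Data.List.Relation.Binary.Subset.Propositional using (_⊆_)
open import Data.List.Relation.Unary.All as All using ()
open import Data.List.Relation.Unary.AllPairs using ([]; _∷_)
open import Data.List.Relation.Unary.Any using (here; there)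
open import Data.List.Relation.Unary.Unique.Propositional using (Unique)
open import Data.Maybe.Base as Maybe using (Maybe; just)
open import Data.Maybe.Properties using (just-injective; map-just; map-∘)
open import Data.Nat.Base using (ℕ; zero; suc; _+_; _≤_; _<_; z≤n; s≤s; s≤s⁻¹; _⊔_)
open import Data.Nat.Properties using (≤-refl; ≤-trans; m≤m+n; m≤n+m; <-irrefl; +-assoc; +-monoˡ-≤; m≤m⊔n; m≤n⊔m; 1+n≰n)
open import Data.Product.Base using (_×_; _,_; ∃-syntax; ∃₂; Σ-syntax; proj₁; proj₂)
open import Data.Sum.Base as Sum using (_⊎_; inj₁; inj₂)
open import Data.Vec.Base as Vec using (Vec; []; _∷_; lookup; _[_]≔_)
import Data.Vec.Properties as Vec
open import Function.Base using (flip; _∘_)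
open import Function.Bundles using (_↔_; _↣_; _⇔_; mk⇔; Inverse; Injection; mk↔ₛ′)
open import Function.Construct.Composition using (_↔-∘_)
open import Function.Construct.Identity using (↔-id)
open import Induction.WellFounded using (Acc; acc; WellFounded)
open import Level using (0ℓ)
open import Relation.Binary.Construct.Closure.Equivalence as Eq using (EqClosure)
open import Relation.Binary.Construct.Closure.ReflexiveTransitive as Star using (Star; ε; _◅_; _◅◅_)
open import Relation.Binary.Construct.Closure.Symmetric as Sym using (SymClosure; fwd; bwd)
open import Relation.Binary.Construct.Composition using (_;_)
open import Relation.Binary.Construct.Union using (_∪_)
open import Relation.Binary.Core using (Rel; _⇒_)
open import Relation.Binary.PropositionalEquality using (_≡_; _≢_; refl; sym; trans; cong; cong₂; subst; subst₂; module ≡-Reasoning)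
open import Relation.Nullary.Decidable.Core using (Dec; yes; no)
open import Relation.Nullary.Negation.Core using (¬_; contradiction)
open import Defs

-- Church–Rosser modulo an equivalence

-- Excluded middle on Σ-types also provides the choices needed to build the
-- infinite sequence.
noInfiniteSequence⇒wellFounded :
  ExcludedMiddle 0ℓ → {A : Set} {_>_ : Rel A 0ℓ} →
  ¬ (Σ[ f ∈ (ℕ → A) ] ((n : ℕ) → f n > f (suc n))) → WellFounded (flip _>_)
noInfiniteSequence⇒wellFounded em {A} {_>_} none x with em {Acc (flip _>_) x}
... | yes a  = a
... | no ¬ax = ⊥-elim (none (proj₁ ∘ points , λ n → proj₁ (proj₂ (next (points n)))))
  where
  Bad : Set
  Bad = Σ[ y ∈ A ] ¬ Acc (flip _>_) y

  next : (b : Bad) → ∃[ z ] (proj₁ b > z × ¬ Acc (flip _>_) z)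
  next (y , ¬ay) with em {∃[ z ] (y > z × ¬ Acc (flip _>_) z)}
  ... | yes w = w
  ... | no ¬w = ⊥-elim (¬ay (acc λ {z} y>z → accessible z y>z))
    where
    accessible : ∀ z → y > z → Acc (flip _>_) z
    accessible z y>z with em {Acc (flip _>_) z}
    ... | yes a = a
    ... | no ¬a = ⊥-elim (¬w (z , y>z , ¬a))

  points : ℕ → Bad
  points zero    = x , ¬ax
  points (suc n) = let z , _ , ¬az = next (points n) in z , ¬az

module Modulo {A : Set} (_⟶_ _⊢⊣_ : Rel A 0ℓ) where

  infix 4 _~_ _⇝_ _↠_ _↓_

  -- The composition operator is U+037E (Greek question mark), not a semicolon.
  _~_ _⇝_ _↓_ _⊸_ _↠_ : Rel A 0ℓ
  _~_ = EqClosure _⊢⊣_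
  _⇝_ = _~_ ; _⟶_ ; _~_
  _↓_ = Star _⟶_ ; _~_ ; flip (Star _⟶_)
  x ⊸ y = x ⟶ y ⊎ SymClosure _⊢⊣_ x y
  _↠_ = Star _⊸_

  ~-sym : ∀ {x y} → x ~ y → y ~ x
  ~-sym = Eq.symmetric _⊢⊣_

  ⟶*⇒↠ : Star _⟶_ ⇒ _↠_
  ⟶*⇒↠ = Star.map inj₁

  ~⇒↠ : _~_ ⇒ _↠_
  ~⇒↠ = Star.map inj₂

  ⟶⇒⇝ : _⟶_ ⇒ _⇝_
  ⟶⇒⇝ s = _ , ε , _ , s , ε

  ~⇝ : ∀ {x y z} → x ~ y → y ⇝ z → x ⇝ z
  ~⇝ x~y (_ , y~a , rest) = _ , x~y ◅◅ y~a , rest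

  ~⟶⇒⇝ : ∀ {x y z} → x ~ y → y ⟶ z → x ⇝ z
  ~⟶⇒⇝ x~y = ~⇝ x~y ∘ ⟶⇒⇝

  ⇝⇒↠ : _⇝_ ⇒ _↠_
  ⇝⇒↠ (_ , x~a , _ , a⟶b , b~y) = ~⇒↠ x~a ◅◅ inj₁ a⟶b ◅ ~⇒↠ b~y

  ↓-refl : ∀ {x} → x ↓ x
  ↓-refl = _ , ε , _ , ε , ε

  ↓-sym : ∀ {x y} → x ↓ y → y ↓ x
  ↓-sym (_ , x⟶*a , _ , a~b , y⟶*b) = _ , y⟶*b , _ , ~-sym a~b , x⟶*a

  ~⇒↓ : _~_ ⇒ _↓_
  ~⇒↓ x~y = _ , ε , _ , x~y , ε

  ↓-expand : ∀ {x x′ y y′} → Star _⟶_ x x′ → Star _⟶_ y y′ → x′ ↓ y′ → x ↓ y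
  ↓-expand x⟶*x′ y⟶*y′ (_ , x′⟶*a , _ , a~b , y′⟶*b) =
    _ , x⟶*x′ ◅◅ x′⟶*a , _ , a~b , y⟶*y′ ◅◅ y′⟶*b

  ↓⇒↠ : ∀ {x y} → x ↓ y → ∃[ b ] (x ↠ b × Star _⟶_ y b)
  ↓⇒↠ (_ , x⟶*a , b , a~b , y⟶*b) = b , ⟶*⇒↠ x⟶*a ◅◅ ~⇒↠ a~b , y⟶*b

  ↠-split : ∀ {x y} → x ↠ y → x ~ y ⊎ ∃[ z ] (x ⇝ z × z ↠ y)
  ↠-split ε              = inj₁ ε
  ↠-split (inj₁ s ◅ rest) = inj₂ (_ , ⟶⇒⇝ s , rest)
  ↠-split (inj₂ e ◅ rest) with ↠-split rest
  ... | inj₁ z~y             = inj₁ (e ◅ z~y)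
  ... | inj₂ (z , x⇝z , z↠y) = inj₂ (z , ~⇝ (e ◅ ε) x⇝z , z↠y)

  -- A cycle through `x` can be rotated so that it starts at the smaller element `y`; repeating this
  -- would descend forever.
  acyclic : ∀ {x y} → Acc (flip _⇝_) x → x ⇝ y → ¬ y ↠ x
  acyclic (acc rec) x⇝y y↠x with ↠-split y↠x
  ... | inj₁ y~x             = acyclic (rec x⇝y) (~⇝ y~x x⇝y) ε
  ... | inj₂ (z , y⇝z , z↠x) = acyclic (rec x⇝y) y⇝z (z↠x ◅◅ ⇝⇒↠ x⇝y)

  Confluent : A → Set
  Confluent x = ∀ {y z} → x ↠ y → x ↠ z → y ↓ z

  ↓-trans : ∀ {x y z} → Confluent y → x ↓ y → y ↓ z → x ↓ z
  ↓-trans conf x↓y y↓z =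
    let _ , y↠b , x⟶*b = ↓⇒↠ (↓-sym x↓y)
        _ , y↠c , z⟶*c = ↓⇒↠ y↓z
    in ↓-expand x⟶*b z⟶*c (conf y↠b y↠c)

  -- The intermediate `v` is a proper reduct of `s`, so the induction hypothesis makes it confluent
  -- and `↓-trans` may pass through it.
  ConnectedBelow : Rel A 0ℓ → Set
  ConnectedBelow _⊸₁_ =
    ∀ {s t u} → s ⊸₁ t → s ⟶ u → ∃[ v ] (s ⟶ v × t ↓ v × v ↓ u)

  module _ (wf : WellFounded (flip _⇝_)) (connected : ConnectedBelow _⊸_) where

    module _ {s : A} (below : ∀ {t v} → s ⇝ t → t ↠ v → Confluent v) where

      local : ∀ {x t u} → s ~ x → x ⊸ t → x ⟶ u → t ↓ u
      local s~x x⊸t x⟶u =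
        let _ , x⟶v , t↓v , v↓u = connected x⊸t x⟶u
        in ↓-trans (below (~⟶⇒⇝ s~x x⟶v) ε) t↓v v↓u

      -- Recursion on the chain of equivalence steps. The term `s` stays fixed while `x` moves
      -- through its class; because `_⇝_` absorbs `_~_`, each one-step reduct of each such `x` is
      -- below `s`.
      cliffs : ∀ {x t w} → s ~ x → x ⟶ t → x ~ w → t ↓ w
      cliffs s~x x⟶t ε = _ , ε , _ , ε , x⟶t ◅ ε
      cliffs {x} {t} {w} s~x x⟶t (_◅_ {j = y} e y~w)
        with local s~x (inj₂ e) x⟶t
      ... | _ , ε , _ , y~b , t⟶*b =
        -- If `y` took no rewrite step, then `t` would lead back to `x`.
        ⊥-elim (acyclic (wf x) (⟶⇒⇝ x⟶t)
                 (⟶*⇒↠ t⟶*b ◅◅ ~⇒↠ (~-sym (e ◅ y~b))))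
      ... | _ , (y⟶y₁ ◅ y₁⟶*a) , _ , a~b , t⟶*b =
        let s~y            = s~x ◅◅ e ◅ ε
            _ , y₁↠c , w⟶*c = ↓⇒↠ (cliffs s~y y⟶y₁ y~w)
        in ↓-expand t⟶*b w⟶*c
             (below (~⟶⇒⇝ s~y y⟶y₁) ε (⟶*⇒↠ y₁⟶*a ◅◅ ~⇒↠ a~b) y₁↠c)

      cliffs* : ∀ {x t u} → s ~ x → x ⇝ t → t ↠ u → ∀ {w} → x ~ w → u ↓ w
      cliffs* s~x x⇝t@(_ , x~a , b , a⟶b , b~t) t↠u x~w =
        let s~a           = s~x ◅◅ x~a
            _ , b↠c , w⟶*c = ↓⇒↠ (cliffs s~a a⟶b (~-sym x~a ◅◅ x~w))
        in ↓-expand ε w⟶*c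
             (below (~⟶⇒⇝ s~a a⟶b) ε (~⇒↠ b~t ◅◅ t↠u) b↠c)

      confluentAt : ∀ {x} → s ~ x → Confluent x
      confluentAt s~x x↠y x↠z with ↠-split x↠y | ↠-split x↠z
      ... | inj₁ x~y | inj₁ x~z = ~⇒↓ (~-sym x~y ◅◅ x~z)
      ... | inj₂ (_ , x⇝t , t↠y) | inj₁ x~z = cliffs* s~x x⇝t t↠y x~z
      ... | inj₁ x~y | inj₂ (_ , x⇝t , t↠z) = ↓-sym (cliffs* s~x x⇝t t↠z x~y)
      ... | inj₂ (_ , x⇝t , t↠y) | inj₂ (_ , (a , x~a , b , a⟶b , b~u) , u↠z)
        with cliffs* s~x x⇝t t↠y x~a
      ... | _ , y⟶*c , _ , c~d , ε =
        ⊥-elim (acyclic (wf _) x⇝t (t↠y ◅◅ ⟶*⇒↠ y⟶*c ◅◅ ~⇒↠ (c~d ◅◅ ~-sym x~a)))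
      -- The first step `a ⟶ a₁` of the join and the given `a ⟶ b` form a one-step peak; closing it
      -- by `local` links the two halves, with `a₁` and `b` both below `s`.
      ... | _ , y⟶*c , d , c~d , (_◅_ {j = a₁} a⟶a₁ a₁⟶*d) =
        let s~a  = s~x ◅◅ x~a
            a₁↓b = local s~a (inj₁ a⟶a₁) a⟶b
            a₁↓z = ↓-trans (below (~⟶⇒⇝ s~a a⟶b) ε) a₁↓b
                     (below (~⟶⇒⇝ s~a a⟶b) ε ε (~⇒↠ b~u ◅◅ u↠z))
        in ↓-trans (below (~⟶⇒⇝ s~a a⟶a₁) ε)
             (_ , y⟶*c , _ , c~d , a₁⟶*d) a₁↓z

    confluent : ∀ s → Confluent s
    confluent s = go (wf s) ε
      where
      go : ∀ {s x} → Acc (flip _⇝_) s → s ↠ x → Confluent x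
      go (acc rec) s↠x with ↠-split s↠x
      ... | inj₁ s~x             = confluentAt (λ s⇝t → go (rec s⇝t)) s~x
      ... | inj₂ (_ , s⇝t , t↠x) = go (rec s⇝t) t↠x

    churchRosser : EqClosure _⊸_ ⇒ _↓_
    churchRosser = Star.fold _↓_ (λ e → ↓-trans (confluent _) (single e)) ↓-refl
      where
      single : SymClosure _⊸_ ⇒ _↓_
      single (fwd e) = confluent _ ε (e ◅ ε)
      single (bwd e) = confluent _ (e ◅ ε) ε

-- Lists without repetitions

Unique-++⁻ʳ : ∀ {A : Set} (xs : List A) {ys} → Unique (xs ++ ys) → Unique ys
Unique-++⁻ʳ []       u       = u
Unique-++⁻ʳ (x ∷ xs) (_ ∷ u) = Unique-++⁻ʳ xs u

Unique-++⁻ˡ : ∀ {A : Set} (xs : List A) {ys} → Unique (xs ++ ys) → Unique xs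
Unique-++⁻ˡ []       u        = []
Unique-++⁻ˡ (x ∷ xs) (px ∷ u) =
  All.tabulate (All.lookup px ∘ ∈-++⁺ˡ) ∷ Unique-++⁻ˡ xs u

Unique-++⇒disjoint : ∀ {A : Set} (xs : List A) {ys z} →
                     Unique (xs ++ ys) → z ∈ xs → z ∉ ys
Unique-++⇒disjoint (x ∷ xs) (px ∷ u) (here refl) z∈ys =
  All.lookup px (∈-++⁺ʳ xs z∈ys) refl
Unique-++⇒disjoint (x ∷ xs) (px ∷ u) (there z∈xs) = Unique-++⇒disjoint xs u z∈xs

module _ {F : Signature} {V : Set} where

  private
    T = Term F V
    Sub = Substitution F V

  -- Substitutions

  fun-injective : ∀ {f g} {ss : Vec T (arity F f)} {ts : Vec T (arity F g)} →
    fun f ss ≡ fun g ts → Σ[ f≡g ∈ f ≡ g ] subst (Vec T ∘ arity F) f≡g ss ≡ ts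
  fun-injective refl = refl , refl

  infixl 9 _⨟_
  _⨟_ : Sub → Sub → Sub
  (σ ⨟ τ) x = σ x · τ

  ·-⨟  : ∀ t (σ τ : Sub) → t · σ · τ ≡ t · (σ ⨟ τ)
  ·ᵛ-⨟ : ∀ {n} (ts : Vec T n) (σ τ : Sub) → ts ·ᵛ σ ·ᵛ τ ≡ ts ·ᵛ (σ ⨟ τ)
  ·-⨟ (var x)    σ τ = refl
  ·-⨟ (fun f ts) σ τ = cong (fun f) (·ᵛ-⨟ ts σ τ)
  ·ᵛ-⨟ []       σ τ = refl
  ·ᵛ-⨟ (t ∷ ts) σ τ = cong₂ _∷_ (·-⨟ t σ τ) (·ᵛ-⨟ ts σ τ)

  ·-var  : ∀ (t : T) → t · var ≡ t
  ·ᵛ-var : ∀ {n} (ts : Vec T n) → ts ·ᵛ var ≡ ts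
  ·-var (var x)    = refl
  ·-var (fun f ts) = cong (fun f) (·ᵛ-var ts)
  ·ᵛ-var []       = refl
  ·ᵛ-var (t ∷ ts) = cong₂ _∷_ (·-var t) (·ᵛ-var ts)

  ·-cong-vars  : ∀ (t : T) {σ τ : Sub} → (∀ {x} → x ∈ vars t → σ x ≡ τ x) →
                 t · σ ≡ t · τ
  ·ᵛ-cong-vars : ∀ {n} (ts : Vec T n) {σ τ : Sub} →
                 (∀ {x} → x ∈ varsᵛ ts → σ x ≡ τ x) → ts ·ᵛ σ ≡ ts ·ᵛ τ
  ·-cong-vars (var x)    h = h (here refl)
  ·-cong-vars (fun f ts) h = cong (fun f) (·ᵛ-cong-vars ts h)
  ·ᵛ-cong-vars []       h = refl
  ·ᵛ-cong-vars (t ∷ ts) h =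
    cong₂ _∷_ (·-cong-vars t (h ∘ ∈-++⁺ˡ)) (·ᵛ-cong-vars ts (h ∘ ∈-++⁺ʳ (vars t)))

  ·-cong : ∀ (t : T) {σ τ : Sub} → (∀ x → σ x ≡ τ x) → t · σ ≡ t · τ
  ·-cong t h = ·-cong-vars t (λ {x} _ → h x)

  ·ᵛ-cong : ∀ {n} (ts : Vec T n) {σ τ : Sub} → (∀ x → σ x ≡ τ x) → ts ·ᵛ σ ≡ ts ·ᵛ τ
  ·ᵛ-cong ts h = ·ᵛ-cong-vars ts (λ {x} _ → h x)

  ·-agree  : ∀ (t : T) {σ τ : Sub} → t · σ ≡ t · τ → ∀ {x} → x ∈ vars t → σ x ≡ τ x
  ·ᵛ-agree : ∀ {n} (ts : Vec T n) {σ τ : Sub} → ts ·ᵛ σ ≡ ts ·ᵛ τ →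
             ∀ {x} → x ∈ varsᵛ ts → σ x ≡ τ x
  ·-agree (var y)    e (here refl) = e
  ·-agree (fun f ts) e x∈ with refl , e′ ← fun-injective e = ·ᵛ-agree ts e′ x∈
  ·ᵛ-agree (t ∷ ts) e x∈ with ∈-++⁻ (vars t) x∈
  ... | inj₁ x∈t  = ·-agree t (Vec.∷-injectiveˡ e) x∈t
  ... | inj₂ x∈ts = ·ᵛ-agree ts (Vec.∷-injectiveʳ e) x∈ts

  lookup-·ᵛ : ∀ {n} (ts : Vec T n) i {σ : Sub} → lookup (ts ·ᵛ σ) i ≡ lookup ts i · σ
  lookup-·ᵛ (t ∷ ts) zero    = refl
  lookup-·ᵛ (t ∷ ts) (suc i) = lookup-·ᵛ ts i

  []≔-·ᵛ : ∀ {n} (ts : Vec T n) i {u} {σ : Sub} →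
           (ts [ i ]≔ u) ·ᵛ σ ≡ (ts ·ᵛ σ) [ i ]≔ (u · σ)
  []≔-·ᵛ (t ∷ ts) zero    = refl
  []≔-·ᵛ (t ∷ ts) (suc i) = cong (_ ∷_) ([]≔-·ᵛ ts i)

  ++-·ᵛ : ∀ {m n} (ss : Vec T m) (ts : Vec T n) {σ : Sub} →
          (ss Vec.++ ts) ·ᵛ σ ≡ (ss ·ᵛ σ) Vec.++ (ts ·ᵛ σ)
  ++-·ᵛ []       ts = refl
  ++-·ᵛ (s ∷ ss) ts = cong (_ ∷_) (++-·ᵛ ss ts)

  -- Positions

  ∣-· : ∀ (t : T) p {v} (σ : Sub) → t ∣ p ≡ just v → (t · σ) ∣ p ≡ just (v · σ)
  argAt-·ᵛ : ∀ {n} (ts : Vec T n) i p {v} (σ : Sub) →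
             argAt ts i p ≡ just v → argAt (ts ·ᵛ σ) i p ≡ just (v · σ)
  ∣-· t          []      σ refl = refl
  ∣-· (fun f ts) (i ∷ p) σ e    = argAt-·ᵛ ts i p σ e
  argAt-·ᵛ (t ∷ ts) zero    p σ e = ∣-· t p σ e
  argAt-·ᵛ (t ∷ ts) (suc i) p σ e = argAt-·ᵛ ts i p σ e

  map-just⁻¹ : ∀ {A B : Set} (f : A → B) (m : Maybe A) {y} →
               Maybe.map f m ≡ just y → ∃[ x ] (m ≡ just x × f x ≡ y)
  map-just⁻¹ f (just x) refl = x , refl , refl

  at-· : ∀ (t : T) p {u w} (σ : Sub) → t [ u ]at p ≡ just w →
         (t · σ) [ u · σ ]at p ≡ just (w · σ)
  replaceArg-·ᵛ : ∀ {n} (ts : Vec T n) i p {u ws} (σ : Sub) →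
    replaceArg ts u i p ≡ just ws → replaceArg (ts ·ᵛ σ) (u · σ) i p ≡ just (ws ·ᵛ σ)
  at-· t          []      σ refl = refl
  at-· (fun f ts) (i ∷ p) {u} σ e with map-just⁻¹ (fun f) (replaceArg ts u i p) e
  ... | ws , e′ , refl = map-just (replaceArg-·ᵛ ts i p σ e′)
  replaceArg-·ᵛ (t ∷ ts) zero    p {u} σ e with map-just⁻¹ (_∷ ts) (t [ u ]at p) e
  ... | w , e′ , refl = map-just (at-· t p σ e′)
  replaceArg-·ᵛ (t ∷ ts) (suc i) p {u} σ e with map-just⁻¹ (t ∷_) (replaceArg ts u i p) e
  ... | ws , e′ , refl = map-just (replaceArg-·ᵛ ts i p σ e′)

  at-defined : ∀ (t : T) p {v} u → t ∣ p ≡ just v → ∃[ w ] t [ u ]at p ≡ just w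
  replaceArg-defined : ∀ {n} (ts : Vec T n) i p {v} u → argAt ts i p ≡ just v →
                       ∃[ ws ] replaceArg ts u i p ≡ just ws
  at-defined t          []      u e = u , refl
  at-defined (fun f ts) (i ∷ p) u e =
    let _ , e′ = replaceArg-defined ts i p u e in _ , map-just e′
  replaceArg-defined (t ∷ ts) zero    p u e =
    let _ , e′ = at-defined t p u e in _ , map-just e′
  replaceArg-defined (t ∷ ts) (suc i) p u e =
    let _ , e′ = replaceArg-defined ts i p u e in _ , map-just e′

  argAt-toℕ : ∀ {n} (ts : Vec T n) i p → argAt ts (toℕ i) p ≡ lookup ts i ∣ p
  argAt-toℕ (t ∷ ts) zero    p = refl
  argAt-toℕ (t ∷ ts) (suc i) p = argAt-toℕ ts i p

  replaceArg-toℕ : ∀ {n} (ts : Vec T n) i p u →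
    replaceArg ts u (toℕ i) p ≡ Maybe.map (ts [ i ]≔_) (lookup ts i [ u ]at p)
  replaceArg-toℕ (t ∷ ts) zero    p u = refl
  replaceArg-toℕ (t ∷ ts) (suc i) p u =
    trans (cong (Maybe.map (t ∷_)) (replaceArg-toℕ ts i p u)) (sym (map-∘ (lookup ts i [ u ]at p)))

  argAt⁻¹ : ∀ {n} (ts : Vec T n) k p {v} → argAt ts k p ≡ just v →
    ∃[ i ] (lookup ts i ∣ p ≡ just v ×
      (∀ u → replaceArg ts u k p ≡ Maybe.map (ts [ i ]≔_) (lookup ts i [ u ]at p)))
  argAt⁻¹ (t ∷ ts) zero    p e = zero , e , λ _ → refl
  argAt⁻¹ (t ∷ ts) (suc k) p e with i , e′ , h ← argAt⁻¹ ts k p e =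
    suc i , e′ , λ u → trans (cong (Maybe.map (t ∷_)) (h u)) (sym (map-∘ (lookup ts i [ u ]at p)))

  -- Steps as context closures

  -- Unlike partial positions, this closure supports structural recursion. `G` is a parameter so
  -- that ordinary, prime and reversed root steps share one closure.
  data Ctx (G : Rel T 0ℓ) : Rel T 0ℓ where
    root : ∀ {s t} → G s t → Ctx G s t
    arg  : ∀ f {ts} i {u} → Ctx G (lookup ts i) u → Ctx G (fun f ts) (fun f (ts [ i ]≔ u))

  record Root (E : Rel T 0ℓ) (s t : T) : Set where
    constructor mkRoot
    field
      {ℓ r}  : T
      σ      : Sub
      rule   : E ℓ r
      redex  : s ≡ ℓ · σ
      result : t ≡ r · σ

  Ctx-map : ∀ {G H : Rel T 0ℓ} → G ⇒ H → Ctx G ⇒ Ctx H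
  Ctx-map g (root x)    = root (g x)
  Ctx-map g (arg f i c) = arg f i (Ctx-map g c)

  frame : ∀ f → Vec T (arity F f) → Fin (arity F f) → T → T
  frame f ts i u = fun f (ts [ i ]≔ u)

  Ctx-frame : ∀ {G s t} f ts i → Ctx G s t → Ctx G (frame f ts i s) (frame f ts i t)
  Ctx-frame {G} {s} {t} f ts i c =
    subst (Ctx G (frame f ts i s)) (cong (fun f) (Vec.[]≔-idempotent ts i))
      (arg f i (subst (λ z → Ctx G z t) (sym (Vec.lookup∘update i ts s)) c))

  Ctx-flip : ∀ {G : Rel T 0ℓ} {s t} → Ctx G s t → Ctx (flip G) t s
  Ctx-flip (root x) = root x
  Ctx-flip {G} (arg f {ts} i {u} c) =
    subst (Ctx (flip G) (fun f (ts [ i ]≔ u))) (cong (fun f) (Vec.[]≔-lookup ts i))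
      (Ctx-frame f ts i (Ctx-flip c))

  Root-· : ∀ {E s t} (τ : Sub) → Root E s t → Root E (s · τ) (t · τ)
  Root-· τ (mkRoot {ℓ} {r} σ rule refl refl) = mkRoot (σ ⨟ τ) rule (·-⨟ ℓ σ τ) (·-⨟ r σ τ)

  Ctx-· : ∀ {E s t} (τ : Sub) → Ctx (Root E) s t → Ctx (Root E) (s · τ) (t · τ)
  Ctx-· τ (root x) = root (Root-· τ x)
  Ctx-· {E} τ (arg f {ts} i {u} c) =
    subst (Ctx (Root E) (fun f (ts ·ᵛ τ))) (cong (fun f) (sym ([]≔-·ᵛ ts i)))
      (arg f i (subst (λ z → Ctx (Root E) z (u · τ)) (sym (lookup-·ᵛ ts i)) (Ctx-· τ c)))

  Ctx⇒at : ∀ {G s t} → Ctx G s t →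
           ∃[ p ] ∃₂ λ v w → G v w × s ∣ p ≡ just v × s [ w ]at p ≡ just t
  Ctx⇒at (root x) = [] , _ , _ , x , refl , refl
  Ctx⇒at (arg f {ts} i c) with p , v , w , x , e , e′ ← Ctx⇒at c =
    toℕ i ∷ p , v , w , x , trans (argAt-toℕ ts i p) e ,
    map-just (trans (replaceArg-toℕ ts i p w) (map-just e′))

  at⇒Ctx : ∀ {G s t} p {v w} → G v w → s ∣ p ≡ just v → s [ w ]at p ≡ just t → Ctx G s t
  at⇒Ctx []                  x refl refl = root x
  at⇒Ctx {s = fun f ts} (k ∷ p) {w = w} x e e′
    with i , eᵢ , replace ← argAt⁻¹ ts k p e
    with ws , e₁ , refl ← map-just⁻¹ (fun f) (replaceArg ts w k p) e′
    with u , e₂ , refl ← map-just⁻¹ (ts [ i ]≔_) (lookup ts i [ w ]at p)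
                           (trans (sym (replace w)) e₁)
    = arg f i (at⇒Ctx p x eᵢ e₂)

  Step⇒Ctx : ∀ {E} → Step E ⇒ Ctx (Root E)
  Step⇒Ctx st = at⇒Ctx p (mkRoot σ rule refl refl) redex result
    where open Step st

  Ctx⇒Step : ∀ {E} → Ctx (Root E) ⇒ Step E
  Ctx⇒Step c with p , _ , _ , mkRoot σ rule refl refl , e , e′ ← Ctx⇒at c =
    record { p = p ; σ = σ ; rule = rule ; redex = e ; result = e′ }

  Step-frame : ∀ {E s t} f ts i → Step E s t → Step E (frame f ts i s) (frame f ts i t)
  Step-frame f ts i = Ctx⇒Step ∘ Ctx-frame f ts i ∘ Step⇒Ctx

  Step-· : ∀ {E s t} (τ : Sub) → Step E s t → Step E (s · τ) (t · τ)
  Step-· τ = Ctx⇒Step ∘ Ctx-· τ ∘ Step⇒Ctx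

  -- Variables of terms and rewriting of all arguments

  vars-rename  : ∀ (t : T) (f : V → V) {y} → y ∈ vars (t · (var ∘ f)) →
                 ∃[ x ] (x ∈ vars t × y ≡ f x)
  varsᵛ-rename : ∀ {n} (ts : Vec T n) (f : V → V) {y} → y ∈ varsᵛ (ts ·ᵛ (var ∘ f)) →
                 ∃[ x ] (x ∈ varsᵛ ts × y ≡ f x)
  vars-rename (var x)    f (here refl) = x , here refl , refl
  vars-rename (fun g ts) f y∈ = varsᵛ-rename ts f y∈
  varsᵛ-rename (t ∷ ts) f y∈ with ∈-++⁻ (vars (t · (var ∘ f))) y∈
  ... | inj₁ y∈t  = let x , x∈ , e = vars-rename t f y∈t in x , ∈-++⁺ˡ x∈ , e
  ... | inj₂ y∈ts = let x , x∈ , e = varsᵛ-rename ts f y∈ts in x , ∈-++⁺ʳ (vars t) x∈ , e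

  varsᵛ-lookup : ∀ {n} (ts : Vec T n) i {x} → x ∈ vars (lookup ts i) → x ∈ varsᵛ ts
  varsᵛ-lookup (t ∷ ts) zero    x∈ = ∈-++⁺ˡ x∈
  varsᵛ-lookup (t ∷ ts) (suc i) x∈ = ∈-++⁺ʳ (vars t) (varsᵛ-lookup ts i x∈)

  Unique-lookup : ∀ {n} (ts : Vec T n) i → Unique (varsᵛ ts) → Unique (vars (lookup ts i))
  Unique-lookup (t ∷ ts) zero    u = Unique-++⁻ˡ (vars t) u
  Unique-lookup (t ∷ ts) (suc i) u = Unique-lookup ts i (Unique-++⁻ʳ (vars t) u)

  -- `C` accumulates the arguments already rewritten, since the recursion runs on tails whose length
  -- no longer fits the arity of the symbol.
  args-steps : ∀ {G n} (C : Vec T n → T) →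
    (∀ us i {u} → Ctx G (lookup us i) u → Ctx G (C us) (C (us [ i ]≔ u))) →
    ∀ ss ts → (∀ i → Star (Ctx G) (lookup ss i) (lookup ts i)) →
    Star (Ctx G) (C ss) (C ts)
  args-steps C closed []       []       h = ε
  args-steps C closed (s ∷ ss) (t ∷ ts) h =
    Star.gmap (λ u → C (u ∷ ss)) (λ {u} → closed (u ∷ ss) zero) (h zero) ◅◅
    args-steps (C ∘ (t ∷_)) (λ us i → closed (t ∷ us) (suc i)) ss ts (h ∘ suc)

  ·-steps  : ∀ {G} {σ τ : Sub} → (∀ x → Star (Ctx G) (σ x) (τ x)) →
             ∀ t → Star (Ctx G) (t · σ) (t · τ)
  ·ᵛ-steps : ∀ {G} {σ τ : Sub} → (∀ x → Star (Ctx G) (σ x) (τ x)) →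
             ∀ {n} (ts : Vec T n) i → Star (Ctx G) (lookup (ts ·ᵛ σ) i) (lookup (ts ·ᵛ τ) i)
  ·-steps h (var x)    = h x
  ·-steps h (fun f ts) = args-steps (fun f) (λ _ i → arg f i) _ _ (·ᵛ-steps h ts)
  ·ᵛ-steps h (t ∷ ts) zero    = ·-steps h t
  ·ᵛ-steps h (t ∷ ts) (suc i) = ·ᵛ-steps h ts i

  -- Updating a substitution at one variable

  module Classical (em : ExcludedMiddle 0ℓ) where

    _≟ᵥ_ : (x y : V) → Dec (x ≡ y)
    x ≟ᵥ y = em

    infix 10 _[_↦_]
    _[_↦_] : Sub → V → T → Sub
    (σ [ x ↦ t ]) y with y ≟ᵥ x
    ... | yes _ = t
    ... | no _  = σ y

    ↦-this : ∀ {σ : Sub} {x t} → (σ [ x ↦ t ]) x ≡ t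
    ↦-this {x = x} with x ≟ᵥ x
    ... | yes _  = refl
    ... | no x≢x = contradiction refl x≢x

    ↦-other : ∀ {σ : Sub} {x t y} → y ≢ x → (σ [ x ↦ t ]) y ≡ σ y
    ↦-other {x = x} {y = y} y≢x with y ≟ᵥ x
    ... | yes y≡x = contradiction y≡x y≢x
    ... | no _    = refl

    ↦-fresh : ∀ (s : T) {σ : Sub} {x t} → x ∉ vars s → s · (σ [ x ↦ t ]) ≡ s · σ
    ↦-fresh s x∉s = ·-cong-vars s (λ y∈s → ↦-other λ { refl → x∉s y∈s })

    -- Renaming apart

    swap : V → V → V → V
    swap a b x with x ≟ᵥ a | x ≟ᵥ b
    ... | yes _ | _     = b
    ... | no _  | yes _ = a
    ... | no _  | no _  = x

    swap-left : ∀ a b → swap a b a ≡ b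
    swap-left a b with a ≟ᵥ a | a ≟ᵥ b
    ... | yes _  | _ = refl
    ... | no a≢a | _ = contradiction refl a≢a

    swap-right : ∀ a b → swap a b b ≡ a
    swap-right a b with b ≟ᵥ a | b ≟ᵥ b
    ... | yes b≡a | _      = b≡a
    ... | no _    | yes _  = refl
    ... | no _    | no b≢b = contradiction refl b≢b

    swap-other : ∀ {a b x} → x ≢ a → x ≢ b → swap a b x ≡ x
    swap-other {a} {b} {x} x≢a x≢b with x ≟ᵥ a | x ≟ᵥ b
    ... | yes x≡a | _       = contradiction x≡a x≢a
    ... | no _    | yes x≡b = contradiction x≡b x≢b
    ... | no _    | no _    = refl

    swap-involutive : ∀ a b x → swap a b (swap a b x) ≡ x
    swap-involutive a b x = go (x ≟ᵥ a) (x ≟ᵥ b)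
      where
      go : Dec (x ≡ a) → Dec (x ≡ b) → swap a b (swap a b x) ≡ x
      go (yes refl) _ = trans (cong (swap a b) (swap-left a b)) (swap-right a b)
      go (no _) (yes refl) = trans (cong (swap a b) (swap-right a b)) (swap-left a b)
      go (no x≢a) (no x≢b) =
        trans (cong (swap a b) (swap-other x≢a x≢b)) (swap-other x≢a x≢b)

    swap-↔ : V → V → V ↔ V
    swap-↔ a b = mk↔ₛ′ (swap a b) (swap a b) (swap-involutive a b) (swap-involutive a b)

    -- By injectivity each listed variable has at most one index, so all indices from some bound on
    -- avoid the list.
    fresh : ℕ ↣ V → ∀ (xs : List V) → ∃[ z ] z ∉ xs
    fresh inj xs = let n , outside = bound xs in Injection.to inj n , outside n ≤-refl
      where
      open Injection inj using (to; injective)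
      bound : ∀ xs → ∃[ n ] (∀ m → n ≤ m → to m ∉ xs)
      bound []       = 0 , λ _ _ ()
      bound (x ∷ xs) with bound xs | em {∃[ k ] to k ≡ x}
      ... | n , outside | no none = n , λ where
        m n≤m (here e)   → none (m , e)
        m n≤m (there m∈) → outside m n≤m m∈
      ... | n , outside | yes (k , refl) = suc k ⊔ n , λ where
        m b≤m (here e)   →
          1+n≰n (subst (suc k ≤_) (injective e) (≤-trans (m≤m⊔n (suc k) n) b≤m))
        m b≤m (there m∈) → outside m (≤-trans (m≤n⊔m (suc k) n) b≤m) m∈

    -- Variants are related by bijections on all of `V`, so the renaming is assembled from
    -- transpositions, one for each variable that still clashes.
    renameApart : ℕ ↣ V → ∀ (xs ys : List V) →
                  Σ[ π ∈ V ↔ V ] (∀ {x} → x ∈ xs → Inverse.to π x ∉ ys)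
    renameApart inj []       ys = ↔-id V , λ ()
    renameApart inj (x ∷ xs) ys with renameApart inj xs ys
    ... | π , apart with em {Inverse.to π x ∈ ys}
    ... | no πx∉ys  = π , λ { (here refl) → πx∉ys ; (there x∈) → apart x∈ }
    ... | yes πx∈ys
      with z , z∉ ← fresh inj (ys ++ List.map (Inverse.to π) xs)
      -- The transposition leaves the earlier images alone: they avoid `ys`, which contains `to x`,
      -- and `z` was chosen outside them.
      = swap-↔ (to x) z ↔-∘ π , λ where
          (here refl) → subst (_∉ ys) (sym (swap-left (to x) z)) (z∉ ∘ ∈-++⁺ˡ)
          (there {x = _} y∈) → subst (_∉ ys)
            (sym (swap-other
              (λ e → apart y∈ (subst (_∈ ys) (sym e) πx∈ys))
              (λ e → z∉ (∈-++⁺ʳ ys (subst (_∈ _) e (∈-map⁺ to y∈))))))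
            (apart y∈)
      where
      open Inverse π using (to)

    -- Unification

    size  : T → ℕ
    sizeᵛ : ∀ {n} → Vec T n → ℕ
    size (var x)    = 1
    size (fun f ts) = suc (sizeᵛ ts)
    sizeᵛ []       = 0
    sizeᵛ (t ∷ ts) = size t + sizeᵛ ts

    size-positive : ∀ t → 0 < size t
    size-positive (var x)    = s≤s z≤n
    size-positive (fun f ts) = s≤s z≤n

    sizeᵛ-++ : ∀ {m n} (ss : Vec T m) (ts : Vec T n) →
               sizeᵛ (ss Vec.++ ts) ≡ sizeᵛ ss + sizeᵛ ts
    sizeᵛ-++ []       ts = refl
    sizeᵛ-++ (s ∷ ss) ts =
      trans (cong (size s +_) (sizeᵛ-++ ss ts)) (sym (+-assoc (size s) (sizeᵛ ss) (sizeᵛ ts)))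

    size-occurs  : ∀ (t : T) {x} (τ : Sub) → x ∈ vars t → size (τ x) ≤ size (t · τ)
    size-occursᵛ : ∀ {n} (ts : Vec T n) {x} (τ : Sub) → x ∈ varsᵛ ts → size (τ x) ≤ sizeᵛ (ts ·ᵛ τ)
    size-occurs (var x)    τ (here refl) = ≤-refl
    size-occurs (fun f ts) τ x∈ = ≤-trans (size-occursᵛ ts τ x∈) (m≤n+m _ 1)
    size-occursᵛ (t ∷ ts) τ x∈ with ∈-++⁻ (vars t) x∈
    ... | inj₁ x∈t  = ≤-trans (size-occurs t τ x∈t) (m≤m+n _ _)
    ... | inj₂ x∈ts = ≤-trans (size-occursᵛ ts τ x∈ts) (m≤n+m _ _)

    -- An occurrence of `x` below the root of `t` would make `t · τ` strictly larger than `τ x`, to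
    -- which it is equal.
    occursCheck : ∀ (t : T) {x} {τ : Sub} → τ x ≡ t · τ → t ≢ var x → x ∉ vars t
    occursCheck (var y)    e t≢x (here refl) = t≢x refl
    occursCheck (fun f ts) {τ = τ} e t≢x x∈  =
      <-irrefl (cong size e) (s≤s (size-occursᵛ ts τ x∈))

    IsMGUᵛ : ∀ {n} → Sub → Vec T n → Vec T n → Set
    IsMGUᵛ σ ss ts = ss ·ᵛ σ ≡ ts ·ᵛ σ ×
      (∀ τ → ss ·ᵛ τ ≡ ts ·ᵛ τ → ∃[ δ ] (∀ x → τ x ≡ σ x · δ))

    bind : V → T → Sub
    bind x t = var [ x ↦ t ]

    bind-absorb : ∀ {x t} {τ : Sub} → τ x ≡ t · τ → ∀ y → (bind x t ⨟ τ) y ≡ τ y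
    bind-absorb {x} {t} {τ} e y = go (y ≟ᵥ x)
      where
      go : Dec (y ≡ x) → (bind x t ⨟ τ) y ≡ τ y
      go (yes refl) = trans (cong (_· τ) (↦-this {σ = var})) (sym e)
      go (no y≢x)   = cong (_· τ) (↦-other {σ = var} y≢x)

    bind-absorbᵛ : ∀ {n} (ss : Vec T n) {x t} {τ : Sub} → τ x ≡ t · τ →
                   ss ·ᵛ bind x t ·ᵛ τ ≡ ss ·ᵛ τ
    bind-absorbᵛ ss e = trans (·ᵛ-⨟ ss _ _) (·ᵛ-cong ss (bind-absorb e))

    -- As `x` does not occur in `t`, the binding fixes `t` and solves the head equation. Most
    -- generality survives because every unifier of that equation absorbs the binding.
    eliminate : ∀ {n} {x t} {ss ts : Vec T n} → x ∉ vars t →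
      ∃[ σ ] IsMGUᵛ σ (ss ·ᵛ bind x t) (ts ·ᵛ bind x t) →
      ∃[ σ ] IsMGUᵛ σ (var x ∷ ss) (t ∷ ts)
    eliminate {x = x} {t} {ss} {ts} x∉t (σ , unifies , general) =
      bind x t ⨟ σ ,
      cong₂ _∷_
        (trans (cong (_· σ) (↦-this {σ = var}))
          (trans (cong (_· σ) (sym (trans (↦-fresh t x∉t) (·-var t)))) (·-⨟ t _ σ)))
        (trans (sym (·ᵛ-⨟ ss _ σ)) (trans unifies (·ᵛ-⨟ ts _ σ))) ,
      λ τ e →
        let τx    = Vec.∷-injectiveˡ e
            δ , h = general τ (trans (bind-absorbᵛ ss τx)
                      (trans (Vec.∷-injectiveʳ e) (sym (bind-absorbᵛ ts τx))))
        in δ , λ y → trans (sym (bind-absorb τx y))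
             (trans (·-cong (bind x t y) h) (sym (·-⨟ (bind x t y) σ δ)))

    -- Instantiating by a unifier τ bounds the run of the algorithm: binding
    -- x to t leaves the size of the remaining equations under τ unchanged.
    mguᵛ : ∀ k {n} (ss ts : Vec T n) (τ : Sub) → ss ·ᵛ τ ≡ ts ·ᵛ τ →
           sizeᵛ (ss ·ᵛ τ) ≤ k → ∃[ σ ] IsMGUᵛ σ ss ts
    mguᵛ k [] [] τ e b = var , refl , λ τ _ → τ , λ _ → refl
    mguᵛ zero (s ∷ ss) (t ∷ ts) τ e b =
      ⊥-elim (1+n≰n (≤-trans (size-positive (s · τ)) (≤-trans (m≤m+n _ _) b)))
    mguᵛ (suc k) (s ∷ ss) (t ∷ ts) τ e b = go s t (Vec.∷-injectiveˡ e) b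
      where
      rest : ss ·ᵛ τ ≡ ts ·ᵛ τ
      rest = Vec.∷-injectiveʳ e

      dropSize : ∀ u → size u + sizeᵛ (ss ·ᵛ τ) ≤ suc k → sizeᵛ (ss ·ᵛ τ) ≤ k
      dropSize u b′ = s≤s⁻¹
        (≤-trans (+-monoˡ-≤ (sizeᵛ (ss ·ᵛ τ)) (size-positive u)) b′)

      bound : ∀ x t → τ x ≡ t · τ → t ≢ var x → sizeᵛ (ss ·ᵛ τ) ≤ k →
              ∃[ σ ] IsMGUᵛ σ (var x ∷ ss) (t ∷ ts)
      bound x t e′ t≢x b′ = eliminate (occursCheck t e′ t≢x)
        (mguᵛ k (ss ·ᵛ bind x t) (ts ·ᵛ bind x t) τ
          (trans (bind-absorbᵛ ss e′) (trans rest (sym (bind-absorbᵛ ts e′))))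
          (subst (λ us → sizeᵛ us ≤ k) (sym (bind-absorbᵛ ss e′)) b′))

      go : ∀ s t → s · τ ≡ t · τ → size (s · τ) + sizeᵛ (ss ·ᵛ τ) ≤ suc k →
           ∃[ σ ] IsMGUᵛ σ (s ∷ ss) (t ∷ ts)
      go (var x) t e′ b′ with em {t ≡ var x}
      ... | no t≢x = bound x t e′ t≢x (dropSize (τ x) b′)
      ... | yes refl =
        let σ , unifies , general = mguᵛ k ss ts τ rest (dropSize (τ x) b′)
        in σ , cong (σ x ∷_) unifies , λ τ′ e″ → general τ′ (Vec.∷-injectiveʳ e″)
      go s@(fun f as) (var x) e′ b′ =
        let σ , unifies , general =
              bound x s (sym e′) (λ ()) (dropSize (s · τ) b′)
        in σ , cong₂ _∷_ (sym (Vec.∷-injectiveˡ unifies)) (Vec.∷-injectiveʳ unifies) ,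
           λ τ′ e″ → general τ′
             (cong₂ _∷_ (sym (Vec.∷-injectiveˡ e″)) (Vec.∷-injectiveʳ e″))
      go (fun f as) (fun g bs) e′ b′ with fun-injective e′
      ... | refl , as≡bs =
        let σ , unifies , general = mguᵛ k (as Vec.++ ss) (bs Vec.++ ts) τ
              (trans (++-·ᵛ as ss) (trans (cong₂ Vec._++_ as≡bs rest) (sym (++-·ᵛ bs ts))))
              (subst (_≤ k)
                (sym (trans (cong sizeᵛ (++-·ᵛ as ss)) (sizeᵛ-++ (as ·ᵛ τ) (ss ·ᵛ τ))))
                (s≤s⁻¹ b′))
            as≡bsσ , ss≡tsσ = Vec.++-injective (as ·ᵛ σ) (bs ·ᵛ σ)
              (trans (sym (++-·ᵛ as ss)) (trans unifies (++-·ᵛ bs ts)))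
        in σ , cong₂ _∷_ (cong (fun f) as≡bsσ) ss≡tsσ ,
           λ τ′ e″ → general τ′
             (trans (++-·ᵛ as ss)
               (trans (cong₂ Vec._++_ (fun-args (Vec.∷-injectiveˡ e″)) (Vec.∷-injectiveʳ e″))
                 (sym (++-·ᵛ bs ts))))
        where
        fun-args : ∀ {us vs : Vec T (arity F f)} → fun f us ≡ fun f vs → us ≡ vs
        fun-args refl = refl

    unifiable⇒mgu : ∀ (s t : T) → Unifiable s t → ∃[ σ ] IsMGU σ s t
    unifiable⇒mgu s t (τ , e) =
      let σ , unifies , general =
            mguᵛ _ (s ∷ []) (t ∷ []) τ (cong (_∷ []) e) ≤-refl
      in σ , Vec.∷-injectiveˡ unifies , λ τ′ e′ → general τ′ (cong (_∷ []) e′)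

    -- Overlaps

    ↦-freshᵛ : ∀ {n} (ts : Vec T n) {σ : Sub} {x t} → x ∉ varsᵛ ts →
               ts ·ᵛ (σ [ x ↦ t ]) ≡ ts ·ᵛ σ
    ↦-freshᵛ ts x∉ts = ·ᵛ-cong-vars ts (λ y∈ts → ↦-other λ { refl → x∉ts y∈ts })

    -- Linearity keeps `x` out of all other arguments, so the update is visible in argument `i`
    -- alone.
    ↦-linear : ∀ {n} (ts : Vec T n) i {σ : Sub} {x w} → Unique (varsᵛ ts) →
      x ∈ vars (lookup ts i) →
      (ts ·ᵛ σ) [ i ]≔ (lookup ts i · σ [ x ↦ w ]) ≡ ts ·ᵛ σ [ x ↦ w ]
    ↦-linear (t ∷ ts) zero    u x∈ =
      cong (_ ∷_) (sym (↦-freshᵛ ts (Unique-++⇒disjoint (vars t) u x∈)))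
    ↦-linear (t ∷ ts) (suc i) u x∈ = cong₂ _∷_
      (sym (↦-fresh t (λ x∈t → Unique-++⇒disjoint (vars t) u x∈t (varsᵛ-lookup ts i x∈))))
      (↦-linear ts i (Unique-++⁻ʳ (vars t) u) x∈)

    ↦-steps : ∀ {G} {σ : Sub} {x w} → Ctx G (σ x) w →
              ∀ y → Star (Ctx G) (σ y) ((σ [ x ↦ w ]) y)
    ↦-steps {x = x} c y with y ≟ᵥ x
    ... | yes refl = c ◅ ε
    ... | no _     = ε

    record FunctionOverlap (G : Rel T 0ℓ) (ℓ : T) (σ : Sub) (t : T) : Set where
      field
        p        : Position
        {v w}    : T
        position : ℓ ∣ p ≡ just v
        nonvar   : ¬ IsVar v
        step     : G (v · σ) w
        result   : (ℓ · σ) [ w ]at p ≡ just t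

    -- A step at one occurrence of `x` spoils the instance of `ℓ` if `x` occurs again. There are two
    -- repairs: `steps` contracts the other copies, while `linear` observes that a linear `ℓ` has
    -- none.
    record VariableOverlap (G : Rel T 0ℓ) (ℓ : T) (σ : Sub) (t : T) : Set where
      field
        {x}    : V
        {w}    : T
        occurs : x ∈ vars ℓ
        step   : Ctx G (σ x) w
        steps  : Star (Ctx G) t (ℓ · σ [ x ↦ w ])
        linear : Unique (vars ℓ) → t ≡ ℓ · σ [ x ↦ w ]

    analyse : ∀ {G} ℓ {σ : Sub} {s t} → Ctx G s t → s ≡ ℓ · σ →
              FunctionOverlap G ℓ σ t ⊎ VariableOverlap G ℓ σ t
    analyse (var x) {σ} {t = t} c refl = inj₂ record
      { occurs = here refl
      ; step   = c
      ; steps  = subst (Star _ t) (sym (↦-this {σ = σ})) ε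
      ; linear = λ _ → sym (↦-this {σ = σ})
      }
    analyse (fun f ls) (root g) refl = inj₁ record
      { p = [] ; position = refl ; nonvar = λ () ; step = g ; result = refl }
    analyse {G} (fun f ls) {σ} (arg f i {u} c) refl with analyse (lookup ls i) c (lookup-·ᵛ ls i)
    ... | inj₁ o = inj₁ record
      { p        = toℕ i ∷ p
      ; position = trans (argAt-toℕ ls i p) position
      ; nonvar   = nonvar
      ; step     = step
      ; result   = map-just (trans (replaceArg-toℕ (ls ·ᵛ σ) i p w)
                     (map-just (trans (cong (λ s → s [ w ]at p) (lookup-·ᵛ ls i)) result)))
      }
      where open FunctionOverlap o
    ... | inj₂ o = inj₂ record
      { occurs = varsᵛ-lookup ls i occurs
      ; step   = step
      ; steps  = args-steps (fun f) (λ _ i → arg f i) _ _ pointwise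
      ; linear = λ u → cong (fun f)
          (trans (cong ((ls ·ᵛ σ) [ i ]≔_) (linear (Unique-lookup ls i u)))
                 (↦-linear ls i u occurs))
      }
      where
      open VariableOverlap o
      pointwise : ∀ j → Star (Ctx G) (lookup ((ls ·ᵛ σ) [ i ]≔ u) j)
                                     (lookup (ls ·ᵛ σ [ x ↦ w ]) j)
      pointwise j with j ≟ i
      ... | yes refl = subst₂ (Star (Ctx G))
              (sym (Vec.lookup∘update i (ls ·ᵛ σ) u)) (sym (lookup-·ᵛ ls i)) steps
      ... | no j≢i = subst (λ s → Star (Ctx G) s _)
              (sym (Vec.lookup∘update′ j≢i (ls ·ᵛ σ) u)) (·ᵛ-steps (↦-steps step) ls j)

  -- Critical pairs

  ±⇒sym : ∀ {B} → Ctx (Root (B ^±)) ⇒ SymClosure (Step {F} {V} B)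
  ±⇒sym c with Ctx⇒at c
  ... | p , _ , _ , mkRoot σ (fwd b) refl refl , e , e′ =
    fwd (Ctx⇒Step (at⇒Ctx p (mkRoot σ b refl refl) e e′))
  ... | p , _ , _ , mkRoot σ (bwd b) refl refl , e , e′ =
    bwd (Ctx⇒Step (Ctx-flip (at⇒Ctx p (mkRoot σ b refl refl) e e′)))

  sym⇒± : ∀ {B} → SymClosure (Step {F} {V} B) ⇒ Ctx (Root (B ^±))
  sym⇒± (fwd s) = Ctx-map (λ (mkRoot σ b e e′) → mkRoot σ (fwd b) e e′) (Step⇒Ctx s)
  sym⇒± (bwd s) = Ctx-map (λ (mkRoot σ b e e′) → mkRoot σ (bwd b) e′ e) (Ctx-flip (Step⇒Ctx s))

  ±-vars : ∀ {B : Rel T 0ℓ} → VariablePreserving B → ∀ {ℓ r} → (B ^±) ℓ r → vars r ⊆ vars ℓ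
  ±-vars vp (fwd b) = proj₂ (vp b)
  ±-vars vp (bwd b) = proj₁ (vp b)

  variant-root : ∀ {E ℓ r} (σ : Sub) → VariantOfElement E (ℓ , r) → Root E (ℓ · σ) (r · σ)
  variant-root σ (ℓ , r , rule , π , refl , refl) =
    mkRoot ((var ∘ Inverse.to π) ⨟ σ) rule (·-⨟ ℓ _ σ) (·-⨟ r _ σ)

  module _ {R B : Rel T 0ℓ} where

    conversion : ∀ {R₁ R₂ : Rel T 0ℓ} →
      Ctx (Root R₁) ⇒ SymClosure (Step (R ∪ B)) →
      Ctx (Root R₂) ⇒ SymClosure (Step (R ∪ B)) →
      PrimeCriticalPair R R₁ R₂ ⇒ EqClosure (Step (R ∪ B))
    conversion left⇒ right⇒ (_ , p , peak , _) with peak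
    ... | record { isOverlap = o ; σ = σ ; mgu = mgu ; source = refl ; left = left ; right = refl } =
      Sym.symmetric _ (left⇒ (at⇒Ctx p (variant-root σ variant₁)
        (trans (∣-· _ p σ position) (cong just (sym (proj₁ mgu)))) left))
      ◅ right⇒ (root (variant-root σ variant₂)) ◅ ε
      where open IsOverlap o

    Step-∪ˡ : Step R ⇒ Step (R ∪ B)
    Step-∪ˡ s = record { p = p ; σ = σ ; rule = inj₁ rule ; redex = redex ; result = result }
      where open Step s

    Step-∪ʳ : Step B ⇒ Step (R ∪ B)
    Step-∪ʳ s = record { p = p ; σ = σ ; rule = inj₂ rule ; redex = redex ; result = result }
      where open Step s

    criticalPairs⇒conversion : (PCP R ∪ PCP± R (B ^±)) ⇒ EqClosure (Step (R ∪ B))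
    criticalPairs⇒conversion = λ where
        (inj₁ cp)        → conversion R⇒ R⇒ cp
        (inj₂ (inj₁ cp)) → conversion R⇒ B⇒ cp
        (inj₂ (inj₂ cp)) → conversion B⇒ R⇒ cp
      where
      R⇒ : Ctx (Root R) ⇒ SymClosure (Step (R ∪ B))
      R⇒ = fwd ∘ Step-∪ˡ ∘ Ctx⇒Step
      B⇒ : Ctx (Root (B ^±)) ⇒ SymClosure (Step (R ∪ B))
      B⇒ = Sym.map Step-∪ʳ ∘ ±⇒sym

  -- Joinability of peaks and cliffs from prime critical pairs

  module CriticalPairs
    (em : ExcludedMiddle 0ℓ) (inj : ℕ ↣ V)
    (B : Rel T 0ℓ) (B-vars : VariablePreserving B)
    (R : Rel T 0ℓ) (R-trs : IsTRS R) (R-linear : LeftLinear R)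
    (joinable : (PCP R ∪ PCP± R (B ^±)) ⇒ JoinableModulo R B)
    where

    open Classical em
    open Modulo (Step R) (Step B)

    ↓-map : ∀ {s t} (f : T → T) → (∀ {E s t} → Step E s t → Step E (f s) (f t)) →
            s ↓ t → f s ↓ f t
    ↓-map f closed (_ , s⟶*a , _ , a~b , t⟶*b) =
      _ , Star.gmap f closed s⟶*a , _ , Eq.gmap f closed a~b , Star.gmap f closed t⟶*b

    -- Normality refers to `R` even if the step itself belongs to `B ^±`, in accordance with
    -- `Prime`.
    record PrimeRoot (E : Rel T 0ℓ) (s t : T) : Set where
      constructor mkPrime
      field
        isRoot : Root E s t
        prime  : ProperSubtermsNormal R s

    Joins : Rel T 0ℓ → Rel T 0ℓ → Set
    Joins E₁ E₂ = ∀ {s t u} → Ctx (PrimeRoot E₁) s t → Root E₂ s u → t ↓ u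

    Ctx-prime⇒Step : ∀ {E} → Ctx (PrimeRoot E) ⇒ Step E
    Ctx-prime⇒Step = Ctx⇒Step ∘ Ctx-map PrimeRoot.isRoot

    -- The peak is an instance of a critical peak for the mgu, unless the rules are variants
    -- overlapping at the root, where both sides coincide. Joinability is closed under substitution.
    functionOverlap-joinable : ∀ {E₁ E₂ : Rel T 0ℓ} →
      (∀ {ℓ r} → E₂ ℓ r → vars r ⊆ vars ℓ) → PrimeCriticalPair R E₁ E₂ ⇒ _↓_ →
      ∀ {ℓ₂ r₂ σ₂ t} → E₂ ℓ₂ r₂ → FunctionOverlap (PrimeRoot E₁) ℓ₂ σ₂ t →
      t ↓ (r₂ · σ₂)
    functionOverlap-joinable {E₁} {E₂} E₂-vars joins {ℓ₂} {r₂} {σ₂} {t} rule₂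
      record { p = p ; v = v ; position = position ; nonvar = nonvar
             ; step = mkPrime (mkRoot {ℓ₁} {r₁} σ₁ rule₁ vσ₂≡ℓ₁σ₁ refl) prime
             ; result = result }
      with π , π-apart ← renameApart inj (pairVars (ℓ₁ , r₁)) (pairVars (ℓ₂ , r₂))
      = cases em
      where
      open Inverse π using (to; from; strictlyInverseʳ)

      ρ : Sub
      ρ = var ∘ to

      ℓ₁′ r₁′ : T
      ℓ₁′ = ℓ₁ · ρ
      r₁′ = r₁ · ρ

      -- One unifier merges both matches: variables of the second rule follow `σ₂`, all others are
      -- renamed back and follow `σ₁`.
      τ : Sub
      τ x with em {x ∈ pairVars (ℓ₂ , r₂)}
      ... | yes _ = σ₂ x
      ... | no _  = σ₁ (from x)

      τ-inside : ∀ {x} → x ∈ pairVars (ℓ₂ , r₂) → τ x ≡ σ₂ x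
      τ-inside {x} x∈ with em {x ∈ pairVars (ℓ₂ , r₂)}
      ... | yes _ = refl
      ... | no x∉ = contradiction x∈ x∉

      τ-outside : ∀ {x} → x ∉ pairVars (ℓ₂ , r₂) → τ x ≡ σ₁ (from x)
      τ-outside {x} x∉ with em {x ∈ pairVars (ℓ₂ , r₂)}
      ... | yes x∈ = contradiction x∈ x∉
      ... | no _   = refl

      τ-renamed : ∀ {x} → x ∈ pairVars (ℓ₁ , r₁) → (ρ ⨟ τ) x ≡ σ₁ x
      τ-renamed x∈ = trans (τ-outside (π-apart x∈)) (cong σ₁ (strictlyInverseʳ _))

      ℓ₂τ : ℓ₂ · τ ≡ ℓ₂ · σ₂
      ℓ₂τ = ·-cong-vars ℓ₂ (τ-inside ∘ ∈-++⁺ˡ)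

      r₂τ : r₂ · τ ≡ r₂ · σ₂
      r₂τ = ·-cong-vars r₂ (τ-inside ∘ ∈-++⁺ʳ (vars ℓ₂))

      vτ : v · τ ≡ v · σ₂
      vτ = just-injective (trans (sym (∣-· ℓ₂ p τ position))
             (trans (cong (_∣ p) ℓ₂τ) (∣-· ℓ₂ p σ₂ position)))

      ℓ₁′τ : ℓ₁′ · τ ≡ ℓ₁ · σ₁
      ℓ₁′τ = trans (·-⨟ ℓ₁ ρ τ) (·-cong-vars ℓ₁ (τ-renamed ∘ ∈-++⁺ˡ))

      r₁′τ : r₁′ · τ ≡ r₁ · σ₁
      r₁′τ = trans (·-⨟ r₁ ρ τ) (·-cong-vars r₁ (τ-renamed ∘ ∈-++⁺ʳ (vars ℓ₁)))

      unifies : IsUnifier τ ℓ₁′ v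
      unifies = trans ℓ₁′τ (trans (sym vσ₂≡ℓ₁σ₁) (sym vτ))

      apart : ∀ {x} → ¬ (x ∈ pairVars (ℓ₁′ , r₁′) × x ∈ pairVars (ℓ₂ , r₂))
      apart (x∈₁ , x∈₂) with ∈-++⁻ (vars ℓ₁′) x∈₁
      ... | inj₁ x∈ with _ , y∈ , refl ← vars-rename ℓ₁ to x∈ = π-apart (∈-++⁺ˡ y∈) x∈₂
      ... | inj₂ x∈ with _ , y∈ , refl ← vars-rename r₁ to x∈ =
        π-apart (∈-++⁺ʳ (vars ℓ₁) y∈) x∈₂

      -- Agreement of the two substitutions on `ℓ₂` carries over to `r₂`, all of whose variables
      -- occur in `ℓ₂`.
      trivial : p ≡ [] → Variant (ℓ₁′ , r₁′) (ℓ₂ , r₂) → t ↓ (r₂ · σ₂)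
      trivial refl (κ , ℓ₁′≡ , r₁′≡) = subst (_↓ (r₂ · σ₂)) (sym t≡) ↓-refl
        where
        κ′ : Sub
        κ′ = var ∘ Inverse.to κ
        agree : ℓ₂ · (κ′ ⨟ τ) ≡ ℓ₂ · τ
        agree = trans (sym (·-⨟ ℓ₂ κ′ τ)) (trans (cong (_· τ) (sym ℓ₁′≡))
                  (trans unifies (cong (_· τ) (sym (just-injective position)))))
        t≡ : t ≡ r₂ · σ₂
        t≡ = begin
          t             ≡⟨ just-injective (sym result) ⟩
          r₁ · σ₁       ≡⟨ r₁′τ ⟨
          r₁′ · τ       ≡⟨ cong (_· τ) r₁′≡ ⟩
          r₂ · κ′ · τ   ≡⟨ ·-⨟ r₂ κ′ τ ⟩
          r₂ · (κ′ ⨟ τ) ≡⟨ ·-cong-vars r₂ (·-agree ℓ₂ agree ∘ E₂-vars rule₂) ⟩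
          r₂ · τ        ≡⟨ r₂τ ⟩
          r₂ · σ₂       ∎
          where open ≡-Reasoning

      critical : ¬ (p ≡ [] × Variant (ℓ₁′ , r₁′) (ℓ₂ , r₂)) → t ↓ (r₂ · σ₂)
      critical nontriv
        with μ , isMGU@(_ , general) ← unifiable⇒mgu ℓ₁′ v (τ , unifies)
        with δ , τ≡ ← general τ unifies
        with t₀ , left ← at-defined (ℓ₂ · μ) p (r₁′ · μ) (∣-· ℓ₂ p μ position)
        = subst₂ _↓_ (sym t≡) (trans (μδ r₂) r₂τ) (↓-map (_· δ) (Step-· δ) (joins pair))
        where
        μδ : ∀ s → s · μ · δ ≡ s · τ
        μδ s = trans (·-⨟ s μ δ) (·-cong s (sym ∘ τ≡))

        t≡ : t ≡ t₀ · δ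
        t≡ = just-injective (begin
          just t                                  ≡⟨ result ⟨
          (ℓ₂ · σ₂) [ r₁ · σ₁ ]at p               ≡⟨ cong₂ (_[_]at p)
                                                        (trans (μδ ℓ₂) ℓ₂τ) (trans (μδ r₁′) r₁′τ) ⟨
          (ℓ₂ · μ · δ) [ r₁′ · μ · δ ]at p        ≡⟨ at-· (ℓ₂ · μ) p δ left ⟩
          just (t₀ · δ)                           ∎)
          where open ≡-Reasoning

        -- Primality passes from the instance to the critical peak: a step in a proper subterm of
        -- `v · μ` would survive instantiation by `δ`.
        isPrime : Prime R (ℓ₂ · μ) p
        isPrime e {q} q≢[] e′ (z , step)
          with refl ← trans (sym e) (∣-· ℓ₂ p μ position)
          = prime q≢[] (subst (λ s → s ∣ q ≡ _) (trans (μδ v) vτ) (∣-· (v · μ) q δ e′))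
                  (_ , Step-· δ step)

        pair : PrimeCriticalPair R E₁ E₂ t₀ (r₂ · μ)
        pair = ℓ₂ · μ , p , record
          { isOverlap = record
              { variant₁  = ℓ₁ , r₁ , rule₁ , π , refl , refl
              ; variant₂  = ℓ₂ , r₂ , rule₂ , ↔-id V , sym (·-var ℓ₂) , sym (·-var r₂)
              ; apart     = apart
              ; position  = position
              ; nonvar    = nonvar
              ; unifiable = τ , unifies
              ; nontriv   = λ p≡[] variant → nontriv (p≡[] , variant)
              }
          ; σ      = μ
          ; mgu    = isMGU
          ; source = refl
          ; left   = left
          ; right  = refl
          } , isPrime

      cases : Dec (p ≡ [] × Variant (ℓ₁′ , r₁′) (ℓ₂ , r₂)) → t ↓ (r₂ · σ₂)
      cases (yes (p≡[] , variant)) = trivial p≡[] variant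
      cases (no nontriv)           = critical nontriv

    joins : ∀ {E₁ E₂ : Rel T 0ℓ} →
      (∀ {ℓ r} → E₂ ℓ r → vars r ⊆ vars ℓ) → PrimeCriticalPair R E₁ E₂ ⇒ _↓_ →
      (∀ {ℓ r σ t} → E₂ ℓ r → VariableOverlap (PrimeRoot E₁) ℓ σ t → t ↓ (r · σ)) →
      Joins E₁ E₂
    joins E₂-vars pairs variables c (mkRoot {ℓ} σ rule redex refl) with analyse ℓ c redex
    ... | inj₁ o = functionOverlap-joinable E₂-vars pairs rule o
    ... | inj₂ o = variables rule o

    -- Contracting the remaining copies of `x` in the left-hand side and all copies in the
    -- right-hand side gives two terms related by one root step of `E`.
    R-variables : ∀ {E} → Root E ⇒ _↓_ →
      ∀ {ℓ r σ t} → E ℓ r → VariableOverlap (PrimeRoot R) ℓ σ t → t ↓ (r · σ)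
    R-variables closed {r = r} rule o =
      ↓-expand (Star.map Ctx-prime⇒Step steps)
               (Star.map Ctx-prime⇒Step (·-steps (↦-steps step) r))
               (closed (mkRoot _ rule refl refl))
      where open VariableOverlap o

    ±*⇒~ : Star (Ctx (PrimeRoot (B ^±))) ⇒ _~_
    ±*⇒~ = Star.map (±⇒sym ∘ Ctx-map PrimeRoot.isRoot)

    -- In `_↓_` the rewrite steps precede `_~_`, so equational steps may not repair the left-hand
    -- side first; linearity lets the rule apply to `t` at once. Copies of `x` in `r` are adjusted
    -- afterwards.
    B-variables : ∀ {ℓ r σ t} → R ℓ r → VariableOverlap (PrimeRoot (B ^±)) ℓ σ t →
                  t ↓ (r · σ)
    B-variables {r = r} rule o =
      _ , Ctx⇒Step (root (mkRoot _ rule (linear (R-linear rule)) refl)) ◅ ε ,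
      _ , ~-sym (±*⇒~ (·-steps (↦-steps step) r)) , ε
      where open VariableOverlap o

    R-joins-R : Joins R R
    R-joins-R = joins (IsTRS.rhs-vars R-trs) (joinable ∘ inj₁)
      (R-variables λ x → _ , Ctx⇒Step (root x) ◅ ε , _ , ε , ε)

    R-joins-B : Joins R (B ^±)
    R-joins-B = joins (±-vars B-vars) (joinable ∘ inj₂ ∘ inj₁)
      (R-variables λ x → ~⇒↓ (±⇒sym (root x) ◅ ε))

    B-joins-R : Joins (B ^±) R
    B-joins-R = joins (IsTRS.rhs-vars R-trs) (joinable ∘ inj₂ ∘ inj₂) B-variables

    -- Rerouting through innermost redexes

    ReducibleProper : T → Set
    ReducibleProper s = ∃₂ λ q v → q ≢ [] × s ∣ q ≡ just v × ∃[ w ] Step R v w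

    ¬reducible⇒normal : ∀ {s} → ¬ ReducibleProper s → ProperSubtermsNormal R s
    ¬reducible⇒normal none q≢[] e red = none (_ , _ , q≢[] , e , red)

    -- The search descends as long as some proper subterm is reducible. Once none is, both `q` and
    -- the position of the step inside the subterm must be the root, so the given step is prime.
    innermost  : ∀ s q {v w} → s ∣ q ≡ just v → Step R v w → ∃[ t ] Ctx (PrimeRoot R) s t
    innermostᵛ : ∀ {n} (ts : Vec T n) k q {v w} → argAt ts k q ≡ just v → Step R v w →
                 ∃[ i ] ∃[ t ] Ctx (PrimeRoot R) (lookup ts i) t
    innermost s q {v} e st with em {ReducibleProper s}
    innermost s        q e st | yes ([] , _ , q≢[] , _) = contradiction refl q≢[]
    innermost (fun f ts) q e st | yes (k ∷ q′ , _ , _ , e′ , _ , st′)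
      with i , _ , c ← innermostᵛ ts k q′ e′ st′ = _ , arg f i c
    innermost s (k ∷ q) e st | no none = contradiction (k ∷ q , _ , (λ ()) , e , _ , st) none
    innermost s [] refl st | no none with Step.p st in p≡
    ... | []    = _ , root (mkPrime (mkRoot (Step.σ st) (Step.rule st) redex refl)
                                (¬reducible⇒normal none))
      where
      redex : s ≡ _
      redex = just-injective (subst (λ p → s ∣ p ≡ _) p≡ (Step.redex st))
    ... | k ∷ p = contradiction
      (_ , _ , (λ p≡[] → contradiction (trans (sym p≡) p≡[]) λ ()) , Step.redex st , _ ,
        Ctx⇒Step (root (mkRoot (Step.σ st) (Step.rule st) refl refl)))
      none
    innermostᵛ (t ∷ ts) zero    q e st = zero , innermost t q e st
    innermostᵛ (t ∷ ts) (suc k) q e st = let i , c = innermostᵛ ts k q e st in suc i , c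

    -- A root step that is not prime has an innermost `R`-redex inside its source; the peak of the
    -- two steps has a prime inner step and is covered by `Joins R E`.
    primeOrBelow : ∀ {E} → Joins R E → ∀ {s t} → Ctx (Root E) s t →
      Ctx (PrimeRoot E) s t ⊎ ∃[ v ] (Ctx (PrimeRoot R) s v × v ↓ t)
    primeOrBelow R-joins-E {s} (root x) with em {ReducibleProper s}
    ... | no none = inj₁ (root (mkPrime x (¬reducible⇒normal none)))
    ... | yes (q , _ , _ , e , _ , st) =
      let v , c = innermost s q e st in inj₂ (v , c , R-joins-E c x)
    primeOrBelow R-joins-E (arg f {ts} i c) with primeOrBelow R-joins-E c
    ... | inj₁ c′           = inj₁ (arg f i c′)
    ... | inj₂ (v , c′ , j) =
      inj₂ (_ , arg f i c′ , ↓-map (frame f ts i) (Step-frame f ts i) j)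

    Connected : T → T → T → Set
    Connected s t u = ∃[ v ] (Step R s v × t ↓ v × v ↓ u)

    Connected-sym : ∀ {s t u} → Connected s t u → Connected s u t
    Connected-sym (v , s⟶v , t↓v , v↓u) = v , s⟶v , ↓-sym v↓u , ↓-sym t↓v

    rootPeak : ∀ {E₁ E₂} → Joins E₁ E₂ → Joins R E₁ → Joins R E₂ →
      ∀ {s t u} → Ctx (Root E₁) s t → Root E₂ s u →
      (t ↓ u) ⊎ Connected s t u
    rootPeak E₁-joins R-joins₁ R-joins₂ c x with primeOrBelow R-joins₁ c
    ... | inj₁ c′             = inj₁ (E₁-joins c′ x)
    ... | inj₂ (v , c′ , v↓t) =
      inj₂ (v , Ctx-prime⇒Step c′ , ↓-sym v↓t , R-joins₂ c′ x)

    orConnected : ∀ {s t u} → Step R s u → t ↓ u ⊎ Connected s t u → Connected s t u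
    orConnected s⟶u (inj₁ t↓u) = _ , s⟶u , t↓u , ↓-refl
    orConnected s⟶u (inj₂ con) = con

    -- Two steps are followed down their common path until one is at the root or the paths part. The
    -- relation `E` is kept abstract to treat peaks and cliffs together.
    peaks : ∀ {E} → Joins E R → Joins R E → (∀ {s t} → Ctx (Root E) s t → s ↓ t) →
      ∀ {s t u} → Ctx (Root E) s t → Ctx (Root R) s u → Connected s t u
    peaks E-joins-R R-joins-E E⇒↓ c (root x) =
      orConnected (Ctx⇒Step (root x)) (rootPeak E-joins-R R-joins-E R-joins-R c x)
    -- Now the `R`-step is the inner one, so the roles are exchanged and the result is reversed.
    peaks E-joins-R R-joins-E E⇒↓ (root x) c@(arg _ _ _) =
      orConnected (Ctx⇒Step c)
        (Sum.map ↓-sym Connected-sym (rootPeak R-joins-E R-joins-R R-joins-E c x))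
    peaks {E} E-joins-R R-joins-E E⇒↓ (arg f {ts} i {a} c) (arg f j {b} d) with i ≟ j
    ... | yes refl =
      let v , st , a↓v , v↓b = peaks E-joins-R R-joins-E E⇒↓ c d
          lift : ∀ {x y} → x ↓ y → frame f ts i x ↓ frame f ts i y
          lift = ↓-map (frame f ts i) (Step-frame f ts i)
      in _ , Ctx⇒Step (arg f i (Step⇒Ctx st)) , lift a↓v , lift v↓b
    -- The steps commute, with common reduct `w`; the right-hand term of the peak itself serves as
    -- the intermediate term.
    ... | no i≢j = _ , Ctx⇒Step (arg f j d) ,
      ↓-expand (Ctx⇒Step t⟶w ◅ ε) ε (↓-sym (E⇒↓ u⟶w)) , ↓-refl
      where
      w : T
      w = fun f ((ts [ i ]≔ a) [ j ]≔ b)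
      t⟶w : Ctx (Root R) (fun f (ts [ i ]≔ a)) w
      t⟶w = arg f j (subst (λ s → Ctx (Root R) s b)
              (sym (Vec.lookup∘update′ (i≢j ∘ sym) ts a)) d)
      u⟶w : Ctx (Root E) (fun f (ts [ j ]≔ b)) w
      u⟶w = subst (Ctx (Root E) _) (cong (fun f) (Vec.[]≔-commutes ts j i (i≢j ∘ sym)))
              (arg f i (subst (λ s → Ctx (Root E) s a)
                (sym (Vec.lookup∘update′ i≢j ts b)) c))

    connectedBelow : ConnectedBelow _⊸_
    connectedBelow (inj₁ s) = peaks R-joins-R R-joins-R
      (λ c → _ , Ctx⇒Step c ◅ ε , _ , ε , ε) (Step⇒Ctx s) ∘ Step⇒Ctx
    connectedBelow (inj₂ s) = peaks B-joins-R R-joins-B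
      (λ c → ~⇒↓ (±⇒sym c ◅ ε)) (sym⇒± s) ∘ Step⇒Ctx

  Step-∪⁻ : ∀ {R B : Rel T 0ℓ} {s t} → Step (R ∪ B) s t → Step R s t ⊎ SymClosure (Step B) s t
  Step-∪⁻ record { p = p ; σ = σ ; rule = inj₁ r ; redex = redex ; result = result } =
    inj₁ record { p = p ; σ = σ ; rule = r ; redex = redex ; result = result }
  Step-∪⁻ record { p = p ; σ = σ ; rule = inj₂ b ; redex = redex ; result = result } =
    inj₂ (fwd record { p = p ; σ = σ ; rule = b ; redex = redex ; result = result })

theorem3p16 : ExcludedMiddle 0ℓ →
    (F : Signature) (V : Set) → ℕ ↣ V →
    (B : Rel (Term F V) 0ℓ) → VariablePreserving B →
    (R : Rel (Term F V) 0ℓ) → IsTRS R → LeftLinear R →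
    TerminatingModulo R B →
    ChurchRosserModulo R B ⇔ ((PCP R ∪ PCP± R (B ^±)) ⇒ JoinableModulo R B)
theorem3p16 em F V inj B B-vars R R-trs R-linear terminating = mk⇔ necessary sufficient
  where
  necessary : ChurchRosserModulo R B → (PCP R ∪ PCP± R (B ^±)) ⇒ JoinableModulo R B
  necessary churchRosser pair = churchRosser (criticalPairs⇒conversion pair)

  sufficient : (PCP R ∪ PCP± R (B ^±)) ⇒ JoinableModulo R B → ChurchRosserModulo R B
  sufficient joinable conversion = Modulo.churchRosser (Step R) (Step B)
    (noInfiniteSequence⇒wellFounded em terminating)
    (CriticalPairs.connectedBelow em inj B B-vars R R-trs R-linear joinable)
    (Eq.map Step-∪⁻ conversion)
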